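{- For every $k\in\mathbb{N}$, the class of graphs of cliquewidth at most $k$ is polynomially $\chi$-bounded; that is, there is a polynomial $f$ (depending on $k$) such that $\chi(G)\leq f(\omega(G))$ for every graph $G$ of cliquewidth at most $k$.
   Context: All graphs are finite and undirected; $\chi(G)$ is the chromatic number and $\omega(G)$ the clique number. A $k$-labelled graph is a graph with a map $\lambda\colon V(G)\to[k]$. Operations on $k$-labelled graphs: for $i\neq j$, $\mathsf{join}_{i,j}$ adds all edges between a vertex of label $i$ and a vertex of label $j$; $\mathsf{rename}_{i\to j}$ changes every label $i$ to $j$; $\mathsf{union}$ takes the disjoint union of two $k$-labelled graphs. The cliquewidth of a graph $G$ is the least $k$ such that some $k$-labelling of $G$ can be built from single-vertex $k$-labelled graphs using these operations. A graph class is polynomially $\chi$-bounded if some polynomial $f$ satisfies $\chi(G)\le f(\omega(G))$ for all graphs $G$ in the class. -}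

module Defs where

open import Data.Nat using (ℕ; zero; suc; _+_; _*_)
open import Data.Bool using (Bool; true; false; _∨_; _∧_)
open import Data.Fin using (Fin; splitAt)
open import Data.Fin.Properties using (_≟_)
open import Data.Sum using (_⊎_; inj₁; inj₂)
open import Data.Product using (Σ; _×_; _,_; ∃)
open import Data.List using (List; []; _∷_)
open import Relation.Nullary using (¬_)
open import Relation.Nullary.Decidable using (⌊_⌋)
open import Relation.Binary.PropositionalEquality using (_≡_; _≢_)
open import Function.Bundles using (_↔_; Inverse)

record Graph : Set where
  field
    n      : ℕ
    adj    : Fin n → Fin n → Bool
    sym    : ∀ u v → adj u v ≡ adj v u
    irrefl : ∀ v → adj v v ≡ false
open Graph public

Colourable : Graph → ℕ → Set
Colourable G c =
  Σ (Fin (n G) → Fin c) λ col → ∀ u v → adj G u v ≡ true → col u ≢ col v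

HasClique : Graph → ℕ → Set
HasClique G s =
  Σ (Fin s → Fin (n G)) λ f →
    (∀ i j → f i ≡ f j → i ≡ j) × (∀ i j → i ≢ j → adj G (f i) (f j) ≡ true)

IsCliqueNumber : Graph → ℕ → Set
IsCliqueNumber G w = HasClique G w × ¬ HasClique G (suc w)

Poly : Set
Poly = List ℕ

eval : Poly → ℕ → ℕ
eval []       x = 0
eval (a ∷ as) x = a + x * eval as x

data CWExpr (k : ℕ) : ℕ → Set where
  vertex : Fin k → CWExpr k 1
  union  : ∀ {m n} → CWExpr k m → CWExpr k n → CWExpr k (m + n)
  join   : ∀ {n} (i j : Fin k) → i ≢ j → CWExpr k n → CWExpr k n
  rename : ∀ {n} (i j : Fin k) → CWExpr k n → CWExpr k n

eqF : ∀ {k} → Fin k → Fin k → Bool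
eqF a b = ⌊ a ≟ b ⌋

label : ∀ {k n} → CWExpr k n → Fin n → Fin k
label (vertex a) _ = a
label (union {m} e₁ e₂) v with splitAt m v
... | inj₁ x = label e₁ x
... | inj₂ y = label e₂ y
label (join i j _ e) v = label e v
label (rename i j e) v with eqF (label e v) i
... | true  = j
... | false = label e v

eadj : ∀ {k n} → CWExpr k n → Fin n → Fin n → Bool
eadj (vertex a) _ _ = false
eadj (union {m} e₁ e₂) u v with splitAt m u | splitAt m v
... | inj₁ x | inj₁ y = eadj e₁ x y
... | inj₂ x | inj₂ y = eadj e₂ x y
... | _      | _      = false
eadj (join i j _ e) u v =
  eadj e u v ∨ (eqF (label e u) i ∧ eqF (label e v) j)
             ∨ (eqF (label e u) j ∧ eqF (label e v) i)
eadj (rename i j e) u v = eadj e u v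

CliquewidthAtMost : ℕ → Graph → Set
CliquewidthAtMost k G =
  Σ (CWExpr k (n G)) λ e →
    Σ (Fin (n G) ↔ Fin (n G)) λ φ →
      ∀ u v → adj G u v ≡ eadj e (Inverse.to φ u) (Inverse.to φ v)

{-# OPTIONS --safe #-}

-- An expression is a binary tree with the vertices as leaves: the adjacency of u and v is decided at their
-- least common ancestor by the labels of u and v just below it.  Mark a set of tree nodes; the level of an
-- edge is the last marked node above both ends.  Initially all nodes are marked, and the edges of a given
-- level form a bipartite graph.  If a marked cluster below a marked node s shows at most r + 1 labels
-- at s, drop greedily those marks whose cluster still shows r + 1 labels at the last mark kept above it.
-- Between two marks of such a stretch the label at s determines all intermediate labels, so, fixing the
-- label at s and the parity of the number of marks above the level, the clusters become modules of the
-- remaining edges, and polynomial χ-boundedness survives by a substitution lemma.  After k rounds only the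
-- root is marked, and all edges have the same level.
--
-- For the substitution lemma let 2 ^ p exceed the clique number, and call a module heavy if it contains a
-- clique of size 2 ^ (p - 1).  Adjacent sibling modules are never both heavy, so heavy modules form
-- independent sets and everything else hangs off chains of them.  Light modules of clique number about
-- 2 ^ i are coloured by induction, siblings are separated by a colouring of a quotient of clique number
-- below 2 ^ (p - i), and a module is separated from those further down a chain by its parent's clique
-- number rounded to multiples of 2 ^ i.
module Submission where

open import Defs
open import Data.Bool using (Bool; true; false; not; _∨_; _∧_) renaming (_≟_ to _≟ᵇ_)
open import Data.Bool.Properties using (not-¬)
open import Data.Empty using (⊥)
open import Data.Fin using (Fin; zero; suc; toℕ; fromℕ<; splitAt; _↑ˡ_; _↑ʳ_)
open import Data.Fin.Properties
  using (any?; pigeonhole; toℕ<n; toℕ-injective; fromℕ<-injective; splitAt⁻¹-↑ˡ; splitAt⁻¹-↑ʳ)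
  renaming (_≟_ to _≟ᶠ_; <⇒≢ to <⇒≢ᶠ)
open import Data.List using ([]; _∷_)
open import Data.Nat
open import Data.Nat.Properties
open import Data.Nat.DivMod using (_/_; _%_; m<n⇒m%n≡m; [m+kn]%n≡m%n; m<n*o⇒m/o<n; m/n≡1+[m∸n]/n; /-monoˡ-≤)
open import Data.Product using (Σ; ∃; _×_; _,_; proj₁; proj₂)
open import Data.Sum using (_⊎_; inj₁; inj₂; [_,_]′)
open import Data.Unit using (⊤; tt)
open import Data.Nat.Tactic.RingSolver using (solve-∀)
open import Function using (_∘_; id)
open import Function.Bundles using (Inverse)
open import Relation.Binary using (tri<; tri≈; tri>)
open import Relation.Binary.PropositionalEquality
  using (_≡_; _≢_; refl; trans; cong; cong₂; subst; subst₂; ≢-sym) renaming (sym to ≡-sym)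
open import Relation.Nullary using (¬_; Dec; yes; no; contradiction)
open import Relation.Nullary.Decidable using (_×-dec_; _⊎-dec_; ¬?; decidable-stable; map′)
open import Relation.Unary using (Decidable)

-- Bounded search

greatest : {Q : ℕ → Set} → Decidable Q → ℕ → ℕ
greatest Q? zero = zero
greatest Q? (suc b) with Q? (suc b)
... | yes _ = suc b
... | no _  = greatest Q? b

module _ {Q : ℕ → Set} (Q? : Decidable Q) where

  greatest-holds : Q 0 → ∀ b → Q (greatest Q? b)
  greatest-holds q zero = q
  greatest-holds q (suc b) with Q? (suc b)
  ... | yes q′ = q′
  ... | no _   = greatest-holds q b

  greatest-≤ : ∀ b → greatest Q? b ≤ b
  greatest-≤ zero = z≤n
  greatest-≤ (suc b) with Q? (suc b)
  ... | yes _ = ≤-refl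
  ... | no _  = m≤n⇒m≤1+n (greatest-≤ b)

  ≤-greatest : ∀ b {s} → s ≤ b → Q s → s ≤ greatest Q? b
  ≤-greatest zero s≤b q = s≤b
  ≤-greatest (suc b) s≤b q with Q? (suc b)
  ... | yes _ = s≤b
  ... | no ¬q with m≤n⇒m<n∨m≡n s≤b
  ...   | inj₁ (s≤s s≤b′) = ≤-greatest b s≤b′ q
  ...   | inj₂ refl = contradiction q ¬q

least : {Q : ℕ → Set} → Decidable Q → ∀ t j → Q (t + j) →
        Σ ℕ λ t′ → t ≤ t′ × Q t′ × (∀ {s} → t ≤ s → s < t′ → ¬ Q s)
least Q? t j q with Q? t
... | yes qt = t , ≤-refl , qt , λ t≤s s<t _ → <⇒≱ s<t t≤s
least {Q} Q? t zero q | no ¬qt = contradiction (subst Q (+-identityʳ t) q) ¬qt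
least {Q} Q? t (suc j) q | no ¬qt with least Q? (suc t) j (subst Q (+-suc t j) q)
... | t′ , t<t′ , qt′ , min = t′ , <⇒≤ t<t′ , qt′ , below
  where
  below : ∀ {s} → t ≤ s → s < t′ → ¬ Q s
  below t≤s s<t′ with m≤n⇒m<n∨m≡n t≤s
  ... | inj₁ t<s  = min t<s s<t′
  ... | inj₂ refl = ¬qt

-- Powers of two and packing colours into bits

1≤2^ : ∀ m → 1 ≤ 2 ^ m
1≤2^ m = m^n>0 2 m

2^-mono-≤ : ∀ {a b} → a ≤ b → 2 ^ a ≤ 2 ^ b
2^-mono-≤ = ^-monoʳ-≤ 2

2^-cancel-< : ∀ {a b} → 2 ^ a < 2 ^ b → a < b
2^-cancel-< {a} {b} lt with a <? b
... | yes a<b = a<b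
... | no a≮b = contradiction (2^-mono-≤ (≮⇒≥ a≮b)) (<⇒≱ lt)

2^-double : ∀ a → 2 ^ a + 2 ^ a ≡ 2 ^ suc a
2^-double a = cong (2 ^ a +_) (≡-sym (+-identityʳ (2 ^ a)))

2^-split : ∀ {i p} → i ≤ p → 2 ^ (p ∸ i) * 2 ^ i ≡ 2 ^ p
2^-split {i} {p} i≤p = trans (≡-sym (^-distribˡ-+-* 2 (p ∸ i) i)) (cong (2 ^_) (m∸n+n≡m i≤p))

quot : ℕ → ℕ → ℕ
quot i w = _/_ w (2 ^ i) {{m^n≢0 2 i}}

quot-< : ∀ {i p w} → i ≤ p → w < 2 ^ p → quot i w < 2 ^ (p ∸ i)
quot-< {i} {p} {w} i≤p w< = m<n*o⇒m/o<n {o = 2 ^ i} {{m^n≢0 2 i}} (subst (w <_) (≡-sym (2^-split i≤p)) w<)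

quot-drop : ∀ {i b w} → 2 ^ i + b ≤ w → quot i b < quot i w
quot-drop {i} {b} {w} le = begin
  suc (quot i b)                   ≡⟨ cong (λ c → suc (quot i c)) (≡-sym (m+n∸m≡n (2 ^ i) b)) ⟩
  suc (quot i (2 ^ i + b ∸ 2 ^ i)) ≡⟨ ≡-sym (m/n≡1+[m∸n]/n {2 ^ i + b} {2 ^ i} (m≤m+n (2 ^ i) b)) ⟩
  quot i (2 ^ i + b)               ≤⟨ /-monoˡ-≤ (2 ^ i) le ⟩
  quot i w                         ∎
  where
  open ≤-Reasoning
  instance
    2^i≢0 : NonZero (2 ^ i)
    2^i≢0 = m^n≢0 2 i

-- Concatenation of bit strings: b takes the low L bits, so bit lengths of palettes add up.
pair : ℕ → ℕ → ℕ → ℕ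
pair L a b = b + a * 2 ^ L

pair-< : ∀ {K L a b} → a < 2 ^ K → b < 2 ^ L → pair L a b < 2 ^ (K + L)
pair-< {K} {L} {a} {b} a< b< = begin-strict
  b + a * 2 ^ L      <⟨ +-monoˡ-< (a * 2 ^ L) b< ⟩
  2 ^ L + a * 2 ^ L  ≤⟨ *-monoˡ-≤ (2 ^ L) a< ⟩
  2 ^ K * 2 ^ L      ≡⟨ ≡-sym (^-distribˡ-+-* 2 K L) ⟩
  2 ^ (K + L)        ∎
  where open ≤-Reasoning

pair-inj : ∀ {L a b c d} → b < 2 ^ L → d < 2 ^ L → pair L a b ≡ pair L c d → a ≡ c × b ≡ d
pair-inj {L} {a} {b} {c} {d} b< d< eq = a≡c , b≡d
  where
  instance
    2^L≢0 : NonZero (2 ^ L)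
    2^L≢0 = m^n≢0 2 L
  b≡d : b ≡ d
  b≡d = trans (≡-sym (trans ([m+kn]%n≡m%n b a (2 ^ L)) (m<n⇒m%n≡m b<)))
              (trans (cong (_% 2 ^ L) eq) (trans ([m+kn]%n≡m%n d c (2 ^ L)) (m<n⇒m%n≡m d<)))
  a≡c : a ≡ c
  a≡c = *-cancelʳ-≡ a c (2 ^ L) (+-cancelˡ-≡ b _ _ (trans eq (cong (_+ c * 2 ^ L) (≡-sym b≡d))))

2^+-< : ∀ {a b c} d → c < 2 ^ a → a < b → 2 ^ a + c < 2 ^ b + d
2^+-< {a} {b} {c} d c< a<b = begin-strict
  2 ^ a + c     <⟨ +-monoʳ-< (2 ^ a) c< ⟩
  2 ^ a + 2 ^ a ≡⟨ 2^-double a ⟩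
  2 ^ suc a     ≤⟨ 2^-mono-≤ a<b ⟩
  2 ^ b         ≤⟨ m≤m+n (2 ^ b) d ⟩
  2 ^ b + d     ∎
  where open ≤-Reasoning

leading-bit : ∀ {h h′ c c′} → c < 2 ^ h → c′ < 2 ^ h′ → 2 ^ h + c ≡ 2 ^ h′ + c′ → h ≡ h′
leading-bit {h} {h′} {c} {c′} c< c′< eq with <-cmp h h′
... | tri≈ _ h≡h′ _ = h≡h′
... | tri< h<h′ _ _ = contradiction eq (<⇒≢ (2^+-< c′ c< h<h′))
... | tri> _ _ h′<h = contradiction (≡-sym eq) (<⇒≢ (2^+-< c c′< h′<h))

-- Colour of a vertex in a class i of light modules: the leading bit encodes i, and leaves room for the
-- p ∸ i bits of q, the A * (p ∸ i) bits of h and the (2 * A + 4) * suc i bits of x, as suc i < p.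
module _ (A p : ℕ) where

  code : ℕ → ℕ → ℕ → ℕ → ℕ
  code i q h x = 2 ^ ((2 * A + 3) * p + i) + pair ((2 * A + 4) * suc i) (pair (A * (p ∸ i)) q h) x

  module _ {i q h x : ℕ} (i< : suc i < p)
    (q< : q < 2 ^ (p ∸ i)) (h< : h < 2 ^ (A * (p ∸ i))) (x< : x < 2 ^ ((2 * A + 4) * suc i)) where

    code-tail-< : pair ((2 * A + 4) * suc i) (pair (A * (p ∸ i)) q h) x < 2 ^ ((2 * A + 3) * p + i)
    code-tail-< = <-≤-trans (pair-< {K = (p ∸ i) + A * (p ∸ i)} (pair-< {K = p ∸ i} q< h<) x<) (2^-mono-≤ bits)
      where
      -- With p written as d + 2 + i, the term A * d + 2 * d is the slack.
      arith : ∀ A i d → (suc (suc d) + A * suc (suc d)) + (2 * A + 4) * suc i + (A * d + 2 * d)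
                        ≡ (2 * A + 3) * (suc (suc d) + i) + i
      arith = solve-∀
      d = p ∸ i ∸ 2
      j≡ : suc (suc d) ≡ p ∸ i
      j≡ = m+[n∸m]≡n (m+n≤o⇒m≤o∸n 2 i<)
      bits : (p ∸ i) + A * (p ∸ i) + (2 * A + 4) * suc i ≤ (2 * A + 3) * p + i
      bits = begin
        (p ∸ i) + A * (p ∸ i) + (2 * A + 4) * suc i
          ≡⟨ cong (λ j → j + A * j + (2 * A + 4) * suc i) (≡-sym j≡) ⟩
        (suc (suc d) + A * suc (suc d)) + (2 * A + 4) * suc i
          ≤⟨ m≤m+n _ (A * d + 2 * d) ⟩
        (suc (suc d) + A * suc (suc d)) + (2 * A + 4) * suc i + (A * d + 2 * d)
          ≡⟨ arith A i d ⟩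
        (2 * A + 3) * (suc (suc d) + i) + i
          ≡⟨ cong (λ j → (2 * A + 3) * (j + i) + i) j≡ ⟩
        (2 * A + 3) * (p ∸ i + i) + i
          ≡⟨ cong (λ j → (2 * A + 3) * j + i) (m∸n+n≡m (<⇒≤ (<-trans (n<1+n i) i<))) ⟩
        (2 * A + 3) * p + i ∎
        where open ≤-Reasoning

    code-< : code i q h x < 2 ^ ((2 * A + 4) * p)
    code-< = begin-strict
      code i q h x                  <⟨ +-monoʳ-< (2 ^ e) code-tail-< ⟩
      2 ^ e + 2 ^ e                 ≡⟨ 2^-double e ⟩
      2 ^ suc e                     ≤⟨ 2^-mono-≤ bits ⟩
      2 ^ ((2 * A + 4) * p)         ∎
      where
      open ≤-Reasoning
      e = (2 * A + 3) * p + i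
      arith : ∀ A p → (2 * A + 3) * p + p ≡ (2 * A + 4) * p
      arith = solve-∀
      bits : suc e ≤ (2 * A + 4) * p
      bits = begin
        suc e                 ≡⟨ ≡-sym (+-suc ((2 * A + 3) * p) i) ⟩
        (2 * A + 3) * p + suc i ≤⟨ +-monoʳ-≤ ((2 * A + 3) * p) (<⇒≤ i<) ⟩
        (2 * A + 3) * p + p   ≡⟨ arith A p ⟩
        (2 * A + 4) * p       ∎

  code-inj : ∀ {i q h x j r g y} →
    suc i < p → q < 2 ^ (p ∸ i) → h < 2 ^ (A * (p ∸ i)) → x < 2 ^ ((2 * A + 4) * suc i) →
    suc j < p → r < 2 ^ (p ∸ j) → g < 2 ^ (A * (p ∸ j)) → y < 2 ^ ((2 * A + 4) * suc j) →
    code i q h x ≡ code j r g y → i ≡ j × q ≡ r × h ≡ g × x ≡ y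
  code-inj {i} {q} {h} {x} {j} {r} {g} {y} i< q< h< x< j< r< g< y< eq
    with +-cancelˡ-≡ ((2 * A + 3) * p) i j
           (leading-bit (code-tail-< i< q< h< x<) (code-tail-< j< r< g< y<) eq)
  ... | refl with pair-inj {(2 * A + 4) * suc i} x< y< (+-cancelˡ-≡ (2 ^ ((2 * A + 3) * p + i)) _ _ eq)
  ... | qh≡rg , x≡y with pair-inj {A * (p ∸ i)} {q} {h} {r} {g} h< g< qh≡rg
  ... | q≡r , h≡g = refl , q≡r , h≡g , x≡y

-- Cliques and colourings of vertex sets

module _ {n : ℕ} where

  -- Recursion into neighbourhoods makes cliques of any decidable relation decidable. Distinctness
  -- of the vertices comes from irreflexivity of E.
  Clique : (Fin n → Fin n → Set) → (Fin n → Set) → ℕ → Set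
  Clique E S zero    = ⊤
  Clique E S (suc s) = ∃ λ v → S v × Clique E (λ u → S u × E v u) s

  clique-mono : ∀ {E E′ : Fin n → Fin n → Set} {S S′ : Fin n → Set} →
    (∀ {u} → S u → S′ u) → (∀ {u v} → S u → S v → E u v → E′ u v) →
    ∀ s → Clique E S s → Clique E′ S′ s
  clique-mono f g zero _ = tt
  clique-mono f g (suc s) (v , Sv , c) =
    v , f Sv , clique-mono (λ (Su , Evu) → f Su , g Sv Su Evu) (λ (Su , _) (Sw , _) → g Su Sw) s c

  clique? : ∀ {E : Fin n → Fin n → Set} {S : Fin n → Set} →
    (∀ u v → Dec (E u v)) → Decidable S → ∀ s → Dec (Clique E S s)
  clique? E? S? zero = yes tt
  clique? E? S? (suc s) = any? λ v → S? v ×-dec clique? E? (λ u → S? u ×-dec E? v u) s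

  clique-≤ : ∀ {E : Fin n → Fin n → Set} {S : Fin n → Set} {r s} →
    r ≤ s → Clique E S s → Clique E S r
  clique-≤ z≤n _ = tt
  clique-≤ (s≤s r≤s) (v , Sv , c) = v , Sv , clique-≤ r≤s c

  clique-join : ∀ {E : Fin n → Fin n → Set} {X Y Z : Fin n → Set} →
    (∀ {y z} → Y y → Z z → E y z) → (∀ {u} → Y u → X u) → (∀ {u} → Z u → X u) →
    ∀ a {b} → Clique E Y a → Clique E Z b → Clique E X (a + b)
  clique-join YZ Y⊆X Z⊆X zero {b} _ cZ = clique-mono Z⊆X (λ _ _ e → e) b cZ
  clique-join YZ Y⊆X Z⊆X (suc a) (v , Yv , cY) cZ =
    v , Y⊆X Yv , clique-join (λ (Yy , _) Zz → YZ Yy Zz) (λ (Yu , Evu) → Y⊆X Yu , Evu)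
                             (λ Zz → Z⊆X Zz , YZ Yv Zz) a cY cZ

  clique→fun : ∀ {E : Fin n → Fin n → Set} {S : Fin n → Set} → (∀ {u v} → E u v → E v u) →
    ∀ s → Clique E S s →
    Σ (Fin s → Fin n) λ f → (∀ i → S (f i)) × (∀ i j → i ≢ j → E (f i) (f j))
  clique→fun Esym zero _ = (λ ()) , (λ ()) , λ ()
  clique→fun {E} {S} Esym (suc s) (v , Sv , c) with clique→fun Esym s c
  ... | f , fS , fE = g , gS , gE
    where
    g : Fin (suc s) → Fin n
    g zero    = v
    g (suc i) = f i
    gS : ∀ i → S (g i)
    gS zero    = Sv
    gS (suc i) = proj₁ (fS i)
    gE : ∀ i j → i ≢ j → E (g i) (g j)
    gE zero    zero    i≢j = contradiction refl i≢j
    gE zero    (suc j) _   = proj₂ (fS j)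
    gE (suc i) zero    _   = Esym (proj₂ (fS i))
    gE (suc i) (suc j) i≢j = fE i j (i≢j ∘ cong suc)

  Col : (Fin n → Fin n → Set) → (Fin n → Set) → ℕ → Set
  Col E S L = Σ (Fin n → ℕ) λ col →
    (∀ u → col u < 2 ^ L) × (∀ {u v} → S u → S v → E u v → col u ≢ col v)

  -- On every vertex set, clique number below 2 ^ p implies chromatic number at most (2 ^ p) ^ A.
  HB : ℕ → (Fin n → Fin n → Set) → Set₁
  HB A E = ∀ {S : Fin n → Set} → Decidable S → ∀ p → ¬ Clique E S (2 ^ p) → Col E S (A * p)

  _within_≥_ : (Fin n → Fin n → Set) → (ℕ → Fin n → Fin n → Set) → ℕ → Fin n → Fin n → Set
  (E within R ≥ t) u v = E u v × R t u v

  -- For equivalence relations, a clique of such edges meets each class of `R (suc t)` at most once;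
  -- these edges stand in for the quotient.
  _at_≥_ : (Fin n → Fin n → Set) → (ℕ → Fin n → Fin n → Set) → ℕ → Fin n → Fin n → Set
  (E at R ≥ t) u v = E u v × R t u v × ¬ R (suc t) u v

-- Substitution

-- The classes of `R t` are modules that shrink to single vertices as t grows. The quotient edges at
-- each depth are bounded with exponent A, and substitution raises it to `2 * A + 4`.
module Substitution {n : ℕ}
  (E : Fin n → Fin n → Set) (E? : ∀ u v → Dec (E u v))
  (E-sym : ∀ {u v} → E u v → E v u) (E-irrefl : ∀ {u} → ¬ E u u)
  (R : ℕ → Fin n → Fin n → Set) (R? : ∀ t u v → Dec (R t u v))
  (R-refl : ∀ {t u} → R t u u) (R-sym : ∀ {t u v} → R t u v → R t v u)
  (R-trans : ∀ {t u v w} → R t u v → R t v w → R t u w)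
  (R-step : ∀ {t u v} → R (suc t) u v → R t u v)
  (D : ℕ) (R-bottom : ∀ {u v} → R D u v → u ≡ v)
  (R-module : ∀ {t u u′ z} → R t u u′ → ¬ R t u z → E u z → E u′ z)
  (A : ℕ) (E-at : ∀ t → HB A (E at R ≥ t))
  where

  R-mono : ∀ {s t u v} → s ≤ t → R t u v → R s u v
  R-mono {s} {t} s≤t r with m≤n⇒m<n∨m≡n s≤t
  R-mono {s} {suc t} _ r | inj₁ (s≤s s≤t) = R-mono s≤t (R-step r)
  ... | inj₂ refl = r

  separation : ∀ {t₀ u v} τ → R t₀ u v → ¬ R τ u v →
    Σ ℕ λ t → t₀ ≤ t × t < τ × R t u v × ¬ R (suc t) u v
  separation zero r₀ ¬r = contradiction (R-mono z≤n r₀) ¬r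
  separation {t₀} {u} {v} (suc τ) r₀ ¬r with R? τ u v
  ... | yes r = τ , ≮⇒≥ (λ τ<t₀ → ¬r (R-mono τ<t₀ r₀)) , n<1+n τ , r , ¬r
  ... | no ¬r′ with separation τ r₀ ¬r′
  ...   | t , t₀≤t , t<τ , rest = t , t₀≤t , m<n⇒m<1+n t<τ , rest

  complete : ∀ {t u v y z} → ¬ R t u v → E u v → R t u y → R t v z → E y z
  complete ¬Ruv Euv Ruy Rvz =
    E-sym (R-module Rvz (λ Rvy → ¬Ruv (R-trans Ruy (R-sym Rvy))) (E-sym (R-module Ruy ¬Ruv Euv)))

  module _ (S : Fin n → Set) where

    Cluster : ℕ → Fin n → Fin n → Set
    Cluster t u v = S v × R t u v

    cluster-join : ∀ {t u v} a {b} → E u v → R t u v → ¬ R (suc t) u v →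
      Clique E (Cluster (suc t) u) a → Clique E (Cluster (suc t) v) b → Clique E (Cluster t u) (a + b)
    cluster-join a Euv Ruv ¬Ruv =
      clique-join (λ (_ , Ruy) (_ , Rvz) → complete ¬Ruv Euv Ruy Rvz)
                  (λ (Sy , Ruy) → Sy , R-step Ruy) (λ (Sz , Rvz) → Sz , R-trans Ruv (R-step Rvz)) a

    blow-up : ∀ {t w} m {P : Fin n → Set} → (∀ {u} → P u → Clique E (Cluster (suc t) u) w) →
      Clique (E at R ≥ t) P m → Clique E (λ x → S x × ∃ λ u → P u × R (suc t) u x) (m * w)
    blow-up zero _ _ = tt
    blow-up {w = w} (suc m) big (v , Pv , c) =
      clique-join (λ (_ , Rvy) (_ , u , (Pu , Evu , _ , ¬Rvu) , Ruz) → complete ¬Rvu Evu Rvy Ruz)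
                  (λ (Sy , Rvy) → Sy , v , Pv , Rvy) (λ (Sz , u , (Pu , _) , Ruz) → Sz , u , Pu , Ruz)
                  w (big Pv) (blow-up m (λ (Pu , _) → big Pu) c)

    blow-up-cluster : ∀ {t w m} {P : Fin n → Set} → (∀ {u} → P u → Clique E (Cluster (suc t) u) w) →
      1 ≤ m → Clique (E at R ≥ t) P m → ∃ λ v → P v × Clique E (Cluster t v) (m * w)
    blow-up-cluster {t} {w} {suc m} {P} big _ (v , Pv , c) = v , Pv ,
      clique-mono (λ (Sx , u , (_ , Rvu) , Rux) → Sx , R-trans Rvu (R-step Rux)) (λ _ _ e → e) (suc m * w)
        -- P is first confined to the class of v, so that the blown-up clique stays in one class of
        -- `R t`.
        (blow-up (suc m) {λ x → P x × R t v x} (λ (Pu , _) → big Pu)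
          (v , (Pv , R-refl) ,
           clique-mono (λ (Pu , e@(_ , Rvu , _)) → (Pu , Rvu) , e) (λ _ _ e → e) m c))

  -- The bound `small` is per class because only edges within classes of `R t₀` are to be coloured;
  -- `recurse` is the induction hypothesis for exponents below p.
  module Colouring (p h : ℕ) (p≡ : p ≡ suc h) (1≤h : 1 ≤ h) {S : Fin n → Set} (S? : Decidable S) (t₀ : ℕ)
    (small : ∀ u → S u → ¬ Clique E (Cluster S t₀ u) (2 ^ p))
    (recurse : ∀ i → i < h → ∀ t {S′ : Fin n → Set} → Decidable S′ →
      (∀ u → S′ u → ¬ Clique E (Cluster S′ t u) (2 ^ suc i)) →
      Col (E within R ≥ t) S′ ((2 * A + 4) * suc i))
    where

    Heavy : ℕ → Fin n → Set
    Heavy t u = Clique E (Cluster S t u) (2 ^ h)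

    cluster-clique? : ∀ t u s → Dec (Clique E (Cluster S t u) s)
    cluster-clique? t u = clique? E? (λ v → S? v ×-dec R? t u v)

    -- The clique number of a cluster, if it is below 2 ^ p; the cap makes W-< unconditional.
    W : ℕ → Fin n → ℕ
    W t u = greatest (cluster-clique? t u) (pred (2 ^ p))

    bottom-light : ∀ u → ¬ Heavy (t₀ + D) u
    -- As `1 ≤ h`, a heavy cluster contains an edge, but clusters this deep are single vertices.
    bottom-light u heavy with clique-≤ {r = 2} (2^-mono-≤ 1≤h) heavy
    ... | v , (_ , Ruv) , w , ((_ , Ruw) , Evw) , _
      with R-bottom (R-mono (m≤n+m D t₀) Ruv) | R-bottom (R-mono (m≤n+m D t₀) Ruw)
    ... | refl | refl = E-irrefl Evw

    first-light : ∀ u → Σ ℕ λ t → t₀ ≤ t × ¬ Heavy t u × (∀ {s} → t₀ ≤ s → s < t → ¬ ¬ Heavy s u)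
    first-light u = least (λ t → ¬? (cluster-clique? t u (2 ^ h))) t₀ D (bottom-light u)

    -- The depth of the largest light cluster around u; the clusters from `t₀` to just above it form
    -- the heavy chain it hangs off.
    τ : Fin n → ℕ
    τ u = proj₁ (first-light u)

    t₀≤τ : ∀ u → t₀ ≤ τ u
    t₀≤τ u = proj₁ (proj₂ (first-light u))

    τ-light : ∀ u → ¬ Heavy (τ u) u
    τ-light u = proj₁ (proj₂ (proj₂ (first-light u)))

    heavy-above : ∀ u {t} → t₀ ≤ t → t < τ u → Heavy t u
    heavy-above u {t} t₀≤t t<τ =
      decidable-stable (cluster-clique? t u (2 ^ h)) (proj₂ (proj₂ (proj₂ (first-light u))) t₀≤t t<τ)

    -- The binary logarithm, rounded down, of the clique number of the light cluster around u.
    ι : Fin n → ℕ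
    ι u = greatest (λ i → 2 ^ i ≤? W (τ u) u) p

    ι≤p : ∀ u → ι u ≤ p
    ι≤p u = greatest-≤ (λ i → 2 ^ i ≤? W (τ u) u) p

    W-clique : ∀ t u → Clique E (Cluster S t u) (W t u)
    W-clique t u = greatest-holds (cluster-clique? t u) tt (pred (2 ^ p))

    W-< : ∀ t u → W t u < 2 ^ p
    W-< t u = ≤-<-trans (greatest-≤ (cluster-clique? t u) (pred (2 ^ p))) (≤-reflexive (suc-pred (2 ^ p) {{m^n≢0 2 p}}))

    size-< : ∀ {t u s} → t₀ ≤ t → S u → Clique E (Cluster S t u) s → s < 2 ^ p
    size-< {t} {u} {s} t₀≤t Su c = ≰⇒> λ 2^p≤s →
      small u Su (clique-mono (λ (Sv , Ruv) → Sv , R-mono t₀≤t Ruv) (λ _ _ e → e) (2 ^ p) (clique-≤ 2^p≤s c))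

    ≤-W : ∀ {t u s} → t₀ ≤ t → S u → Clique E (Cluster S t u) s → s ≤ W t u
    ≤-W {t} {u} t₀≤t Su c =
      ≤-greatest (cluster-clique? t u) (pred (2 ^ p)) (<⇒≤pred (size-< t₀≤t Su c)) c

    1≤W : ∀ u → S u → 1 ≤ W (τ u) u
    1≤W u Su = ≤-W (t₀≤τ u) Su (u , (Su , R-refl) , tt)

    2^ι≤W : ∀ u → S u → 2 ^ ι u ≤ W (τ u) u
    2^ι≤W u Su = greatest-holds (λ i → 2 ^ i ≤? W (τ u) u) (1≤W u Su) p

    ι< : ∀ u → S u → ι u < h
    ι< u Su = 2^-cancel-< (≤-<-trans (2^ι≤W u Su) (≰⇒> λ le → τ-light u (clique-≤ le (W-clique (τ u) u))))

    1+ι< : ∀ u → S u → suc (ι u) < p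
    1+ι< u Su = subst (suc (ι u) <_) (≡-sym p≡) (s≤s (ι< u Su))

    W<2^1+ι : ∀ u → S u → W (τ u) u < 2 ^ suc (ι u)
    W<2^1+ι u Su = ≰⇒> λ le →
      1+n≰n (≤-greatest (λ i → 2 ^ i ≤? W (τ u) u) p (<⇒≤ (1+ι< u Su)) le)

    τ-least : ∀ u {t} → t₀ ≤ t → ¬ Heavy t u → τ u ≤ t
    τ-least u t₀≤t light = ≮⇒≥ λ t<τ → light (heavy-above u t₀≤t t<τ)

    heavy-resp : ∀ {t u v} → R t u v → Heavy t u → Heavy t v
    heavy-resp Ruv = clique-mono (λ (Sw , Ruw) → Sw , R-trans (R-sym Ruv) Ruw) (λ _ _ e → e) (2 ^ h)

    τ-resp : ∀ {u v} → R (τ u) u v → τ v ≡ τ u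
    τ-resp {u} {v} Ruv = ≤-antisym τv≤τu
      (τ-least u (t₀≤τ v) (τ-light v ∘ heavy-resp (R-mono τv≤τu Ruv)))
      where
      τv≤τu = τ-least v (t₀≤τ u) (τ-light u ∘ heavy-resp (R-sym Ruv))

    Class : ℕ → ℕ → Fin n → Set
    Class i t v = S v × τ v ≡ t × ι v ≡ i

    class? : ∀ i t → Decidable (Class i t)
    class? i t v = S? v ×-dec (τ v ≟ t ×-dec ι v ≟ i)

    inner : ∀ i → i < h → ∀ t → Col (E within R ≥ t) (Class i t) ((2 * A + 4) * suc i)
    inner i i< t = recurse i i< t (class? i t) λ { u (Su , refl , refl) c → <⇒≱ (W<2^1+ι u Su)
      (≤-W (t₀≤τ u) Su (clique-mono (λ ((Sv , _) , Ruv) → Sv , Ruv) (λ _ _ e → e) (2 ^ suc (ι u)) c)) }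

    inner-cong : ∀ {i j t t′} i< j< → i ≡ j → t ≡ t′ → ∀ v → proj₁ (inner i i< t) v ≡ proj₁ (inner j j< t′) v
    inner-cong i< j< refl refl v = cong (λ lt → proj₁ (inner _ lt _) v) (≤-irrelevant i< j<)

    -- With a clique of size `2 ^ i` in each light cluster, a quotient clique of size `2 ^ (p ∸ i)`
    -- would blow up to size `2 ^ p`. By `t₀ ≤ t` it would lie in a class of `R t₀`, against
    -- `small`.
    outer : ∀ i t → Col (E at R ≥ t) (λ v → Class i (suc t) v × t₀ ≤ t) (A * (p ∸ i))
    outer i t = E-at t (λ v → class? i (suc t) v ×-dec t₀ ≤? t) (p ∸ i) no-clique
      where
      big : ∀ {u} → Class i (suc t) u × t₀ ≤ t → Clique E (Cluster S (suc t) u) (2 ^ i)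
      big {u} ((Su , τ≡ , refl) , _) =
        clique-≤ (2^ι≤W u Su) (subst (λ s → Clique E (Cluster S s u) (W (τ u) u)) τ≡ (W-clique (τ u) u))
      no-clique : ¬ Clique (E at R ≥ t) (λ v → Class i (suc t) v × t₀ ≤ t) (2 ^ (p ∸ i))
      too-big : (∃ λ v → (Class i (suc t) v × t₀ ≤ t) × Clique E (Cluster S t v) (2 ^ (p ∸ i) * 2 ^ i)) → ⊥
      too-big (v , ((Sv , _ , ι≡) , t₀≤t) , c) =
        <-irrefl (2^-split (subst (_≤ p) ι≡ (ι≤p v))) (size-< t₀≤t Sv c)
      no-clique c = too-big (blow-up-cluster S big (1≤2^ (p ∸ i)) c)

    -- Depth `pred (τ u)` is that of the parent of the light cluster. When `τ u ≡ t₀` no parent is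
    -- in range, and the value is a mere filler within the bound `q-<`.
    q : Fin n → ℕ
    q u = quot (ι u) (W (pred (τ u)) u)

    q-< : ∀ u → q u < 2 ^ (p ∸ ι u)
    q-< u = quot-< (ι≤p u) (W-< (pred (τ u)) u)

    -- A light cluster at u hanging off a heavy path lowers the clique number of the path by 2 ^ ι u.
    q-drop : ∀ {u v t} → S u → S v → E u v → t₀ ≤ t → R t u v → ¬ R (suc t) u v →
      suc t ≡ τ u → suc t < τ v → ι u ≡ ι v → q v < q u
    q-drop {u} {v} {t} Su Sv Euv t₀≤t Ruv ¬Ruv t+1≡ t+1< ι≡ =
      subst₂ (λ i s → quot i (W (pred (τ v)) v) < quot (ι u) (W s u)) ι≡ (cong pred t+1≡)
        (quot-drop {ι u} (≤-W t₀≤t Su (cluster-join S (2 ^ ι u) Euv Ruv ¬Ruv cu cv)))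
      where
      cu : Clique E (Cluster S (suc t) u) (2 ^ ι u)
      cu = clique-≤ (2^ι≤W u Su) (subst (λ s → Clique E (Cluster S s u) (W (τ u) u)) (≡-sym t+1≡) (W-clique (τ u) u))
      cv : Clique E (Cluster S (suc t) v) (W (pred (τ v)) v)
      cv = clique-mono (λ (Sw , Rvw) → Sw , R-mono (<⇒≤pred t+1<) Rvw) (λ _ _ e → e) (W (pred (τ v)) v) (W-clique (pred (τ v)) v)

    c-outer : Fin n → ℕ
    c-outer u = proj₁ (outer (ι u) (pred (τ u))) u

    c-outer-< : ∀ u → c-outer u < 2 ^ (A * (p ∸ ι u))
    c-outer-< u = proj₁ (proj₂ (outer (ι u) (pred (τ u)))) u

    c-inner : ∀ u → S u → ℕ
    c-inner u Su = proj₁ (inner (ι u) (ι< u Su) (τ u)) u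

    c-inner-< : ∀ u Su → c-inner u Su < 2 ^ ((2 * A + 4) * suc (ι u))
    c-inner-< u Su = proj₁ (proj₂ (inner (ι u) (ι< u Su) (τ u))) u

    colour : ∀ u → Dec (S u) → ℕ
    colour u (yes Su) = code A p (ι u) (q u) (c-outer u) (c-inner u Su)
    colour u (no _)   = 0

    colour-< : ∀ u S?u → colour u S?u < 2 ^ ((2 * A + 4) * p)
    colour-< u (yes Su) = code-< A p (1+ι< u Su) (q-< u) (c-outer-< u) (c-inner-< u Su)
    colour-< u (no _)   = 1≤2^ ((2 * A + 4) * p)

    module _ {u v : Fin n} (Su : S u) (Sv : S v) (Euv : E u v) (R₀uv : R t₀ u v)
      (ι≡ : ι u ≡ ι v) (q≡ : q u ≡ q v) (outer≡ : c-outer u ≡ c-outer v) (inner≡ : c-inner u Su ≡ c-inner v Sv) where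

      same-light-cluster : ¬ R (τ u) u v
      same-light-cluster Ruv = proj₂ (proj₂ (inner (ι u) (ι< u Su) (τ u)))
        (Su , refl , refl) (Sv , τ-resp Ruv , ≡-sym ι≡) (Euv , Ruv)
        (trans inner≡ (inner-cong (ι< v Sv) (ι< u Su) (≡-sym ι≡) (τ-resp Ruv) v))

      same-light-cluster′ : ¬ R (τ v) u v
      same-light-cluster′ Ruv = same-light-cluster (subst (λ s → R s u v) (≡-sym (τ-resp (R-sym Ruv))) Ruv)

      -- Just below the parting of u and v, each end is in a heavy cluster or in its light cluster.
      -- Two heavy ones join to a clique of size `2 ^ p`, a light and a heavy one differ in `q`, and
      -- two light ones differ in `c-outer`.
      meet : ∀ {t} → t₀ ≤ t → R t u v → ¬ R (suc t) u v →
        suc t < τ u ⊎ suc t ≡ τ u → suc t < τ v ⊎ suc t ≡ τ v → ⊥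
      meet t₀≤t Ruv ¬Ruv (inj₁ t+1<τu) (inj₁ t+1<τv) =
        <-irrefl (trans (2^-double h) (cong (2 ^_) (≡-sym p≡)))
          (size-< t₀≤t Su (cluster-join S (2 ^ h) Euv Ruv ¬Ruv
            (heavy-above u (m≤n⇒m≤1+n t₀≤t) t+1<τu) (heavy-above v (m≤n⇒m≤1+n t₀≤t) t+1<τv)))
      meet t₀≤t Ruv ¬Ruv (inj₂ t+1≡τu) (inj₁ t+1<τv) =
        <-irrefl (≡-sym q≡) (q-drop Su Sv Euv t₀≤t Ruv ¬Ruv t+1≡τu t+1<τv ι≡)
      meet t₀≤t Ruv ¬Ruv (inj₁ t+1<τu) (inj₂ t+1≡τv) =
        <-irrefl q≡ (q-drop Sv Su (E-sym Euv) t₀≤t (R-sym Ruv) (¬Ruv ∘ R-sym) t+1≡τv t+1<τu (≡-sym ι≡))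
      meet {t} t₀≤t Ruv ¬Ruv (inj₂ t+1≡τu) (inj₂ t+1≡τv) =
        proj₂ (proj₂ (outer (ι u) t))
          ((Su , ≡-sym t+1≡τu , refl) , t₀≤t) ((Sv , ≡-sym t+1≡τv , ≡-sym ι≡) , t₀≤t) (Euv , Ruv , ¬Ruv)
          (trans (cong (λ s → proj₁ (outer (ι u) s) u) (cong pred t+1≡τu))
            (trans outer≡
              (trans (cong (λ s → proj₁ (outer (ι v) s) v) (cong pred (≡-sym t+1≡τv)))
                (cong (λ i → proj₁ (outer i t) v) (≡-sym ι≡)))))

      clash : ⊥
      clash =
        let t , t₀≤t , t<τu , Ruv , ¬Ruv = separation (τ u) R₀uv same-light-cluster
            t<τv = ≰⇒> (λ τv≤t → same-light-cluster′ (R-mono τv≤t Ruv))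
        in meet t₀≤t Ruv ¬Ruv (m≤n⇒m<n∨m≡n t<τu) (m≤n⇒m<n∨m≡n t<τv)

    colouring : Col (E within R ≥ t₀) S ((2 * A + 4) * p)
    colouring = (λ u → colour u (S? u)) , (λ u → colour-< u (S? u)) , λ {u} {v} → proper u v (S? u) (S? v)
      where
      proper : ∀ u v S?u S?v → S u → S v → (E within R ≥ t₀) u v → colour u S?u ≢ colour v S?v
      proper u v (no ¬Su) _        Su _  _ _ = ¬Su Su
      proper u v _        (no ¬Sv) _  Sv _ _ = ¬Sv Sv
      proper u v (yes Su) (yes Sv) _  _  (Euv , R₀uv) eq =
        let ι≡ , q≡ , outer≡ , inner≡ =
              code-inj A p (1+ι< u Su) (q-< u) (c-outer-< u) (c-inner-< u Su)
                           (1+ι< v Sv) (q-< v) (c-outer-< v) (c-inner-< v Sv) eq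
        in clash Su Sv Euv R₀uv ι≡ q≡ outer≡ inner≡

  -- Strong induction on p with fuel N. For p at most 1 there is no edge within a cluster, so one
  -- colour does.
  clusterwise : ∀ N p → p ≤ N → ∀ t {S : Fin n → Set} → Decidable S →
    (∀ u → S u → ¬ Clique E (Cluster S t u) (2 ^ p)) → Col (E within R ≥ t) S ((2 * A + 4) * p)
  clusterwise _ zero _ t S? small =
    (λ _ → 0) , (λ _ → 1≤2^ ((2 * A + 4) * 0)) , λ {u} Su _ _ _ → small u Su (u , (Su , R-refl) , tt)
  clusterwise _ (suc zero) _ t S? small =
    (λ _ → 0) , (λ _ → 1≤2^ ((2 * A + 4) * 1)) , λ {u} {v} Su Sv (Euv , Ruv) _ →
      small u Su (u , (Su , R-refl) , v , ((Sv , Ruv) , Euv) , tt)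
  clusterwise (suc N) (suc (suc p)) (s≤s p≤N) t S? small =
    Colouring.colouring (2 + p) (suc p) refl (s≤s z≤n) S? t small (λ i i< → clusterwise N (suc i) (≤-trans i< p≤N))

  substitution : (∀ {u v} → E u v → R 0 u v) → HB (2 * A + 4) E
  substitution E⊆R₀ S? p no-clique with clusterwise p p ≤-refl 0 S?
    (λ u Su c → no-clique (clique-mono proj₁ (λ _ _ e → e) (2 ^ p) c))
  ... | col , col-< , proper = col , col-< , λ Su Sv Euv → proper Su Sv (Euv , E⊆R₀ Euv)

HB-resp : ∀ {n A} {E E′ : Fin n → Fin n → Set} →
  (∀ {u v} → E u v → E′ u v) → (∀ {u v} → E′ u v → E u v) → HB A E → HB A E′
HB-resp f g hb S? p no-clique with hb S? p (λ c → no-clique (clique-mono id (λ _ _ → f) (2 ^ p) c))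
... | col , col-< , proper = col , col-< , λ Su Sv e → proper Su Sv (g e)

distinct-labels-≤ : ∀ {n k s} (f : Fin n → Fin k) {S : Fin n → Set} →
  Clique (λ u v → f u ≢ f v) S s → s ≤ k
distinct-labels-≤ {n} {k} {s} f c with clique→fun ≢-sym s c
... | g , _ , g-distinct = ≮⇒≥ λ k<s →
  let i , j , i<j , eq = pigeonhole k<s (f ∘ g) in g-distinct i j (<⇒≢ᶠ i<j) eq

-- If every f-class is a union of g-classes and X meets as many f-classes as it may meet g-classes,
-- then f and g agree on X.
rigid : ∀ {n k} {f g : Fin n → Fin k} r {X : Fin n → Set} →
  (∀ {v w} → X v → X w → g v ≡ g w → f v ≡ f w) →
  Clique (λ u v → f u ≢ f v) X r → ¬ Clique (λ u v → g u ≢ g v) X (suc r) →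
  ∀ {a b} → X a → X b → f a ≡ f b → g a ≡ g b
rigid zero g⇒f _ few {a} Xa _ _ = contradiction (a , Xa , tt) few
rigid {f = f} {g} (suc r) {X} g⇒f (v , Xv , c) few {a} {b} Xa Xb fa≡fb with f v ≟ᶠ f a
... | no fv≢fa = rigid r (λ (Xv , _) (Xw , _) → g⇒f Xv Xw) c
      (λ c′ → few (v , Xv , clique-mono (λ (Xu , fv≢fu) → Xu , fv≢fu ∘ g⇒f Xv Xu) (λ _ _ e → e) (suc r) c′))
      (Xa , fv≢fa) (Xb , λ fv≡fb → fv≢fa (trans fv≡fb (≡-sym fa≡fb))) fa≡fb
... | yes fv≡fa with g a ≟ᶠ g b
...   | yes ga≡gb = ga≡gb
-- Replacing v by a and b gives one g-class more than `few` permits.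
...   | no ga≢gb = contradiction
        (a , Xa , b , (Xb , ga≢gb) ,
         clique-mono (λ (Xu , fv≢fu) → (Xu , λ ga≡gu → fv≢fu (trans fv≡fa (g⇒f Xa Xu ga≡gu))) ,
                                       λ gb≡gu → fv≢fu (trans fv≡fa (trans fa≡fb (g⇒f Xb Xu gb≡gu))))
                     (λ (Xu , _) (Xw , _) fu≢fw → fu≢fw ∘ g⇒f Xu Xw) r c)
        few

-- Labelled trees

-- A tree node at depth t is represented by the set of vertices whose branches share their first t
-- steps.
Agree : ∀ {n} → (Fin n → ℕ → Bool) → ℕ → Fin n → Fin n → Set
Agree side t u v = ∀ i → i < t → side u i ≡ side v i

flip-when : {P : Set} → Dec P → Bool → Bool
flip-when (yes _) b = not b
flip-when (no _)  b = b

flip-when-yes : {P : Set} (P? : Dec P) {b : Bool} → P → flip-when P? b ≡ not b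
flip-when-yes (yes _) _ = refl
flip-when-yes (no ¬p) p = contradiction p ¬p

flip-when-no : {P : Set} (P? : Dec P) {b : Bool} → ¬ P → flip-when P? b ≡ b
flip-when-no (yes p) ¬p = contradiction p ¬p
flip-when-no (no _)  _  = refl

choose : {P Q : Set} → Dec P → Dec Q → ℕ → ℕ → ℕ
choose (yes _) (no _)  x y = x
choose (yes _) (yes _) x y = y
choose (no _)  _       x y = y

choose-case : {P Q : Set} (P? : Dec P) (Q? : Dec Q) (x y : ℕ) →
  ((P × ¬ Q) × choose P? Q? x y ≡ x) ⊎ ((¬ P ⊎ Q) × choose P? Q? x y ≡ y)
choose-case (yes p) (no ¬q) x y = inj₁ ((p , ¬q) , refl)
choose-case (yes _) (yes q) x y = inj₂ (inj₂ q , refl)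
choose-case (no ¬p) _       x y = inj₂ (inj₁ ¬p , refl)

n<2^n : ∀ n → n < 2 ^ n
n<2^n zero    = s≤s z≤n
n<2^n (suc n) = subst (suc (suc n) ≤_) (2^-double n) (+-mono-≤ (1≤2^ n) (n<2^n n))

-- Per round: k bits for a label and one substitution for each parity.
next-bound : ℕ → ℕ → ℕ
next-bound k A = k + ((2 * A + 4) + (2 * A + 4))

bound : ℕ → ℕ → ℕ → ℕ
bound k zero    A = A
bound k (suc r) A = bound k r (next-bound k A)

-- A labelled tree in the abstract: labels that are equal at a node stay equal further up, and the
-- neighbours of u outside a node depend only on the label of u there.
module System {n k : ℕ}
  (E : Fin n → Fin n → Set) (E? : ∀ u v → Dec (E u v))
  (E-sym : ∀ {u v} → E u v → E v u) (E-irrefl : ∀ {u} → ¬ E u u)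
  (side : Fin n → ℕ → Bool) (lab : Fin n → ℕ → Fin k)
  (D : ℕ) (side-injective : ∀ {u v} → Agree side D u v → u ≡ v)
  (lab-adj : ∀ t {u u′ z} → Agree side t u u′ → lab u t ≡ lab u′ t → ¬ Agree side t u z → E u z → E u′ z)
  (lab-step : ∀ t {u v} → Agree side (suc t) u v → lab u (suc t) ≡ lab v (suc t) → lab u t ≡ lab v t)
  where

  Ag : ℕ → Fin n → Fin n → Set
  Ag = Agree side

  ag-refl : ∀ {t u} → Ag t u u
  ag-refl i _ = refl

  ag-sym : ∀ {t u v} → Ag t u v → Ag t v u
  ag-sym a i i<t = ≡-sym (a i i<t)

  ag-trans : ∀ {t u v w} → Ag t u v → Ag t v w → Ag t u w
  ag-trans a b i i<t = trans (a i i<t) (b i i<t)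

  ag-mono : ∀ {s t u v} → s ≤ t → Ag t u v → Ag s u v
  ag-mono s≤t a i i<s = a i (≤-trans i<s s≤t)

  agree? : ∀ t u v → Dec (Ag t u v)
  agree? t u v = map′ (λ a i → a {i}) (λ a {i} → a i) (allUpTo? (λ i → side u i ≟ᵇ side v i) t)

  lab-mono : ∀ {s t u v} → s ≤ t → Ag t u v → lab u t ≡ lab v t → lab u s ≡ lab v s
  lab-mono {s} {t} s≤t a eq with m≤n⇒m<n∨m≡n s≤t
  lab-mono {s} {suc t} _ a eq | inj₁ (s≤s s≤t) = lab-mono s≤t (ag-mono (n≤1+n t) a) (lab-step t a eq)
  ... | inj₂ refl = eq

  E⇒≢ : ∀ {u v} → E u v → u ≢ v
  E⇒≢ Euv refl = E-irrefl Euv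

  -- For distinct vertices, the depth of their least common ancestor.
  ℓ : Fin n → Fin n → ℕ
  ℓ u v = greatest (λ t → agree? t u v) D

  ℓ≤D : ∀ u v → ℓ u v ≤ D
  ℓ≤D u v = greatest-≤ (λ t → agree? t u v) D

  ℓ-agree : ∀ u v → Ag (ℓ u v) u v
  ℓ-agree u v = greatest-holds (λ t → agree? t u v) (λ _ ()) D

  ≤-ℓ : ∀ {t u v} → u ≢ v → Ag t u v → t ≤ ℓ u v
  ≤-ℓ {t} {u} {v} u≢v a =
    ≤-greatest (λ t → agree? t u v) D (≮⇒≥ λ D<t → u≢v (side-injective (ag-mono (<⇒≤ D<t) a))) a

  Differ : ℕ → Fin n → Fin n → Set
  Differ s u v = lab u s ≢ lab v s

  differ? : ∀ s u v → Dec (Differ s u v)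
  differ? s u v = ¬? (lab u s ≟ᶠ lab v s)

  -- The marked depths of u are the fixed points of λ t → m t u, and m t u is the last one up to t.
  record Marks : Set where
    field
      m      : ℕ → Fin n → ℕ
      m-zero : ∀ u → m 0 u ≡ 0
      m-suc  : ∀ t u → m (suc t) u ≡ suc t ⊎ m (suc t) u ≡ m t u
      m-resp : ∀ t {u v} → Ag t u v → m t u ≡ m t v

    m-≤ : ∀ t u → m t u ≤ t
    m-≤ zero u = ≤-reflexive (m-zero u)
    m-≤ (suc t) u with m-suc t u
    ... | inj₁ e = ≤-reflexive e
    ... | inj₂ e = ≤-trans (≤-reflexive e) (m≤n⇒m≤1+n (m-≤ t u))

    m-skip : ∀ t u → m (suc t) u ≡ m t u → m (suc t) u ≢ suc t
    m-skip t u e e′ = 1+n≰n (≤-trans (≤-reflexive (trans (≡-sym e′) e)) (m-≤ t u))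

    m-mono : ∀ {s t} u → s ≤ t → m s u ≤ m t u
    m-mono {s} {t} u s≤t with m≤n⇒m<n∨m≡n s≤t
    ... | inj₂ refl = ≤-refl
    m-mono {s} {suc t} u _ | inj₁ (s≤s s≤t) with m-suc t u
    ... | inj₁ e = ≤-trans (m-≤ s u) (≤-trans (m≤n⇒m≤1+n s≤t) (≤-reflexive (≡-sym e)))
    ... | inj₂ e = ≤-trans (m-mono u s≤t) (≤-reflexive (≡-sym e))

    m-idem : ∀ t u → m (m t u) u ≡ m t u
    m-idem zero u = cong (λ t → m t u) (m-zero u)
    m-idem (suc t) u with m-suc t u
    ... | inj₁ e = cong (λ t → m t u) e
    ... | inj₂ e = trans (cong (λ t → m t u) e) (trans (m-idem t u) (≡-sym e))

    par : ℕ → Fin n → Bool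
    par zero    u = false
    par (suc t) u = flip-when (m (suc t) u ≟ suc t) (par t u)

    par-resp : ∀ t {u v} → Ag t u v → par t u ≡ par t v
    par-resp zero a = refl
    par-resp (suc t) a = cong₂ (λ x b → flip-when (x ≟ suc t) b) (m-resp (suc t) a) (par-resp t (ag-mono (n≤1+n t) a))

    par-m : ∀ t u → par (m t u) u ≡ par t u
    par-m zero u = cong (λ t → par t u) (m-zero u)
    par-m (suc t) u with m-suc t u
    ... | inj₁ e = cong (λ t → par t u) e
    ... | inj₂ e = trans (cong (λ t → par t u) e)
                     (trans (par-m t u) (≡-sym (flip-when-no (m (suc t) u ≟ suc t) (m-skip t u e))))

    -- If t and t′ were consecutive marks, the parity would flip exactly once, at t′.
    mark-between : ∀ {t t′ u} → t < t′ → m t u ≡ t → m t′ u ≡ t′ → par t u ≡ par t′ u →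
      Σ ℕ λ t″ → t < t″ × t″ < t′ × m t″ u ≡ t″
    mark-between {t} {suc t₁} {u} (s≤s t≤t₁) mt mt′ par≡
      with m≤n⇒m<n∨m≡n (≤-trans (≤-reflexive (≡-sym mt)) (m-mono u t≤t₁))
    ... | inj₁ t<m = m t₁ u , t<m , s≤s (m-≤ t₁ u) , m-idem t₁ u
    ... | inj₂ t≡m = contradiction
            (trans (≡-sym (par-m t₁ u)) (trans (cong (λ s → par s u) (≡-sym t≡m))
              (trans par≡ (flip-when-yes (m (suc t₁) u ≟ suc t₁) mt′))))
            (not-¬ refl)

    lev : Fin n → Fin n → ℕ
    lev u v = m (ℓ u v) u

    lev-≤D : ∀ u v → lev u v ≤ D
    lev-≤D u v = ≤-trans (m-≤ (ℓ u v) u) (ℓ≤D u v)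

    lev-mark : ∀ u v → m (lev u v) u ≡ lev u v
    lev-mark u v = m-idem (ℓ u v) u

    lev-agree : ∀ u v → Ag (lev u v) u v
    lev-agree u v = ag-mono (m-≤ (ℓ u v) u) (ℓ-agree u v)

    ≤-lev : ∀ {t u v} → u ≢ v → m t u ≡ t → Ag t u v → t ≤ lev u v
    ≤-lev {u = u} u≢v mt a = ≤-trans (≤-reflexive (≡-sym mt)) (m-mono u (≤-ℓ u≢v a))

    mark-resp : ∀ {t u v} → Ag t u v → m t u ≡ t → m t v ≡ t
    mark-resp {t} a mt = trans (≡-sym (m-resp t a)) mt

    lev-sym : ∀ {u v} → u ≢ v → lev u v ≡ lev v u
    lev-sym {u} {v} u≢v = ≤-antisym (half (u≢v ∘ ≡-sym)) (half u≢v)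
      where
      half : ∀ {u v} → v ≢ u → lev u v ≤ lev v u
      half {u} {v} v≢u = ≤-lev v≢u (mark-resp (lev-agree u v) (lev-mark u v)) (ag-sym (lev-agree u v))

    -- Marks above both u and z lie before depth t, where the branches of u and u′ coincide.
    lev-resp : ∀ {t u u′ z} → Ag t u u′ → ¬ Ag t u z → lev u z ≡ lev u′ z
    lev-resp {t} a ¬a = ≤-antisym (half a ¬a) (half (ag-sym a) (¬a ∘ ag-trans a))
      where
      half : ∀ {u u′ z} → Ag t u u′ → ¬ Ag t u z → lev u z ≤ lev u′ z
      half {u} {u′} {z} a ¬a = ≤-lev (λ { refl → ¬a a }) (mark-resp a′ (lev-mark u z)) (ag-trans (ag-sym a′) (lev-agree u z))
        where
        a′ : Ag (lev u z) u u′
        a′ = ag-mono (<⇒≤ (≰⇒> λ t≤lev → ¬a (ag-mono t≤lev (lev-agree u z)))) a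

  -- A clique of `Differ s` has pairwise distinct labels at s, so r bounds the number of labels that
  -- the node at t shows at s.
  Ranked : ℕ → Marks → Set
  Ranked r M = ∀ {s t u} → s < t → m s u ≡ s → m t u ≡ t → ¬ Clique (Differ s) (Ag t u) (suc r)
    where open Marks M

  Levels : ℕ → Marks → Set₁
  Levels A M = ∀ s → HB A (λ u v → E u v × lev u v ≡ s)
    where open Marks M

  module Thinning (M : Marks) (r : ℕ) (ranked : Ranked (suc r) M) (A : ℕ) (levels : Levels A M) where
    open Marks M

    mutual

      m′ : ℕ → Fin n → ℕ
      m′ zero    u = 0
      m′ (suc t) u = choose (m (suc t) u ≟ suc t) (wide? t u) (suc t) (m′ t u)

      Wide : ℕ → Fin n → Set
      Wide t u = Clique (Differ (m′ t u)) (Ag (suc t) u) (suc r)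

      wide? : ∀ t u → Dec (Wide t u)
      wide? t u = clique? (differ? (m′ t u)) (agree? (suc t) u) (suc r)

    m′-case : ∀ t u → ((m (suc t) u ≡ suc t × ¬ Wide t u) × m′ (suc t) u ≡ suc t) ⊎
                      ((m (suc t) u ≢ suc t ⊎ Wide t u) × m′ (suc t) u ≡ m′ t u)
    m′-case t u = choose-case (m (suc t) u ≟ suc t) (wide? t u) (suc t) (m′ t u)

    m′-resp : ∀ t {u v} → Ag t u v → m′ t u ≡ m′ t v
    m′-resp zero _ = refl
    m′-resp (suc t) {u} {v} a = align (m′-case t u) (m′-case t v)
      where
      ih : m′ t u ≡ m′ t v
      ih = m′-resp t (ag-mono (n≤1+n t) a)
      wide-resp : ∀ {u v} → Ag (suc t) u v → m′ t u ≡ m′ t v → Wide t u → Wide t v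
      wide-resp {u} {v} a eq = clique-mono (ag-trans (ag-sym a)) (λ _ _ → subst (λ s → Differ s _ _) eq) (suc r)
      align : _ → _ → m′ (suc t) u ≡ m′ (suc t) v
      align (inj₁ (_ , e)) (inj₁ (_ , e′)) = trans e (≡-sym e′)
      align (inj₂ (_ , e)) (inj₂ (_ , e′)) = trans e (trans ih (≡-sym e′))
      align (inj₁ ((mu , _) , _)) (inj₂ (inj₁ ¬mv , _)) = contradiction (mark-resp a mu) ¬mv
      align (inj₁ ((_ , ¬w) , _)) (inj₂ (inj₂ w , _))   = contradiction (wide-resp (ag-sym a) (≡-sym ih) w) ¬w
      align (inj₂ (inj₁ ¬mu , _)) (inj₁ ((mv , _) , _)) = contradiction (mark-resp (ag-sym a) mv) ¬mu
      align (inj₂ (inj₂ w , _)) (inj₁ ((_ , ¬w) , _))   = contradiction (wide-resp a ih w) ¬w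

    M′ : Marks
    M′ = record
      { m      = m′
      ; m-zero = λ _ → refl
      ; m-suc  = λ t u → m′-suc (m′-case t u)
      ; m-resp = m′-resp
      }
      where
      m′-suc : ∀ {P Q : Set} {a b c : ℕ} → (P × a ≡ b) ⊎ (Q × a ≡ c) → a ≡ b ⊎ a ≡ c
      m′-suc (inj₁ (_ , e)) = inj₁ e
      m′-suc (inj₂ (_ , e)) = inj₂ e

    open Marks M′ using () renaming (m-≤ to m′-≤; m-mono to m′-mono; m-skip to m′-skip; lev to lev′)

    -- `m′` changes only at old marks; thus the old level of an edge determines the new one.
    m′-m : ∀ t u → m′ (m t u) u ≡ m′ t u
    m′-m zero u = cong (λ t → m′ t u) (m-zero u)
    m′-m (suc t) u with m-suc t u
    ... | inj₁ e = cong (λ t → m′ t u) e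
    ... | inj₂ e = trans (cong (λ t → m′ t u) e) (trans (m′-m t u) (≡-sym (unmarked (m′-case t u))))
      where
      unmarked : _ → m′ (suc t) u ≡ m′ t u
      unmarked (inj₁ ((mu , _) , _)) = contradiction mu (m-skip t u e)
      unmarked (inj₂ (_ , e′))       = e′

    -- A kept mark shows at most r labels at the last mark kept above it, and labels at s, no deeper
    -- than that mark, are coarser still.
    ranked′ : Ranked r M′
    ranked′ {s} {suc t} {u} (s≤s s≤t) ms mt c = go (m′-case t u)
      where
      s≤m : s ≤ m′ t u
      s≤m = ≤-trans (≤-reflexive (≡-sym ms)) (m′-mono u s≤t)
      go : _ → ⊥
      go (inj₁ ((_ , ¬w) , _)) = ¬w (clique-mono id
        (λ av aw d eq → d (lab-mono s≤m (ag-mono (m≤n⇒m≤1+n (m′-≤ t u)) (ag-trans (ag-sym av) aw)) eq)) (suc r) c)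
      go (inj₂ (_ , e)) = m′-skip t u e mt

    -- Marks dropped by the thinning sit in a stretch of constant rank.
    dropped-wide : ∀ t {u} → m t u ≡ t → m′ t u ≢ t → Clique (Differ (m′ t u)) (Ag t u) (suc r)
    dropped-wide zero _ ¬m′ = contradiction refl ¬m′
    dropped-wide (suc t) {u} mt ¬m′ = go (m′-case t u)
      where
      go : _ → Clique (Differ (m′ (suc t) u)) (Ag (suc t) u) (suc r)
      go (inj₁ (_ , e))      = contradiction e ¬m′
      go (inj₂ (inj₁ ¬m , _)) = contradiction mt ¬m
      go (inj₂ (inj₂ w , e)) = subst (λ s → Clique (Differ s) (Ag (suc t) u) (suc r)) (≡-sym e) w

    module _ (s : ℕ) (b : Bool) where

      Q : ℕ → Fin n → Set
      Q t u = m t u ≡ t × m′ t u ≡ s × par t u ≡ b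

      Q? : ∀ t u → Dec (Q t u)
      Q? t u = m t u ≟ t ×-dec (m′ t u ≟ s ×-dec par t u ≟ᵇ b)

      Q-resp : ∀ {t u v} → Ag t u v → Q t u → Q t v
      Q-resp {t} a (mt , m′t , pt) =
        mark-resp a mt , trans (≡-sym (m′-resp t a)) m′t , trans (≡-sym (par-resp t a)) pt

      -- Edges of new level s, cut down to equal labels at s and one parity of the old level, so
      -- that the classes of `R` become modules.
      F : Fin n → Fin n → Set
      F u v = E u v × lab u s ≡ lab v s × Q (lev u v) u

      F? : ∀ u v → Dec (F u v)
      F? u v = E? u v ×-dec (lab u s ≟ᶠ lab v s ×-dec Q? (lev u v) u)

      F-sym : ∀ {u v} → F u v → F v u
      F-sym {u} {v} (Euv , l , q) =
        E-sym Euv , ≡-sym l , subst (λ t → Q t v) (lev-sym (E⇒≢ Euv)) (Q-resp (lev-agree u v) q)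

      -- A class is spanned by the first `Q`-node at depth t or deeper on a branch, split by labels
      -- at s; a vertex without such a node is alone.
      R : ℕ → Fin n → Fin n → Set
      R t u v = u ≡ v ⊎ (lab u s ≡ lab v s × ∃ λ t′ → t′ < suc D × t ≤ t′ × Q t′ u × Ag t′ u v)

      R? : ∀ t u v → Dec (R t u v)
      R? t u v = u ≟ᶠ v ⊎-dec (lab u s ≟ᶠ lab v s ×-dec
        anyUpTo? (λ t′ → t ≤? t′ ×-dec (Q? t′ u ×-dec agree? t′ u v)) (suc D))

      R-sym : ∀ {t u v} → R t u v → R t v u
      R-sym (inj₁ e) = inj₁ (≡-sym e)
      R-sym (inj₂ (l , t′ , t′< , t≤ , q , a)) = inj₂ (≡-sym l , t′ , t′< , t≤ , Q-resp a q , ag-sym a)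

      R-trans : ∀ {t u v w} → R t u v → R t v w → R t u w
      R-trans (inj₁ refl) r = r
      R-trans (inj₂ r) (inj₁ refl) = inj₂ r
      R-trans (inj₂ (l , t₁ , t₁< , t≤t₁ , q₁ , a₁)) (inj₂ (l′ , t₂ , t₂< , t≤t₂ , q₂ , a₂)) with ≤-total t₁ t₂
      ... | inj₁ le = inj₂ (trans l l′ , t₁ , t₁< , t≤t₁ , q₁ , ag-trans a₁ (ag-mono le a₂))
      ... | inj₂ le = let a = ag-mono le a₁ in
                      inj₂ (trans l l′ , t₂ , t₂< , t≤t₂ , Q-resp (ag-sym a) q₂ , ag-trans a a₂)

      R-step : ∀ {t u v} → R (suc t) u v → R t u v
      R-step (inj₁ e) = inj₁ e
      R-step (inj₂ (l , t′ , t′< , t< , rest)) = inj₂ (l , t′ , t′< , <⇒≤ t< , rest)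

      R-bottom : ∀ {u v} → R (suc D) u v → u ≡ v
      R-bottom (inj₁ e) = e
      R-bottom (inj₂ (_ , t′ , t′< , D<t′ , _)) = contradiction D<t′ (<⇒≱ t′<)

      F⇒R : ∀ {t u v} → t ≤ lev u v → F u v → R t u v
      F⇒R {t} {u} {v} t≤ (_ , l , q) = inj₂ (l , lev u v , s≤s (lev-≤D u v) , t≤ , q , lev-agree u v)

      -- The common node t′ of u and u′ is a dropped mark, so it shows r + 1 labels at s, and by
      -- `ranked` no more at a mark t″ above it. Hence, by `rigid`, equal labels at s force equal
      -- labels at t″, a node that z is outside of.
      R-module : ∀ {t u u′ z} → R t u u′ → ¬ R t u z → F u z → F u′ z
      R-module (inj₁ refl) _ f = f
      R-module {t₀} {u} {u′} {z} (inj₂ (l , t′ , _ , t₀≤t′ , q′@(mt′ , m′t′ , pt′) , a)) ¬R f@(Euz , lz , q@(mt , m′t , pt)) =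
        Eu′z , trans (≡-sym l) lz , subst (λ t → Q t u′) (lev-resp a ¬a) (Q-resp (ag-mono (<⇒≤ t<t′) a) q)
        where
        t = lev u z
        u≢z = E⇒≢ Euz
        t<t′ : t < t′
        t<t′ = <-≤-trans (≰⇒> λ t₀≤t → ¬R (F⇒R t₀≤t f)) t₀≤t′
        ¬Ag : ∀ {i} → t < i → m i u ≡ i → ¬ Ag i u z
        ¬Ag t<i mi a = <⇒≱ t<i (≤-lev u≢z mi a)
        ¬a : ¬ Ag t′ u z
        ¬a = ¬Ag t<t′ mt′
        s≤t : s ≤ t
        s≤t = ≤-trans (≤-reflexive (≡-sym m′t)) (m′-≤ t u)
        wide : Clique (Differ s) (Ag t′ u) (suc r)
        wide = subst (λ s → Clique (Differ s) (Ag t′ u) (suc r)) m′t′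
          -- Had t′ been kept, s would equal t′, but s ≤ t < t′.
          (dropped-wide t′ mt′ (λ e → <⇒≱ t<t′ (subst (_≤ t) (trans (≡-sym m′t′) e) s≤t)))
        -- By parity there is a mark t″ strictly between t and t′, at which u and u′ have equal labels.
        via : (Σ ℕ λ t″ → t < t″ × t″ < t′ × m t″ u ≡ t″) → E u′ z
        via (t″ , t<t″ , t″<t′ , mt″) =
          lab-adj t″ (ag-mono (<⇒≤ t″<t′) a)
            (rigid (suc r) {Ag t′ u}
              (λ av aw → lab-mono (≤-trans s≤t (<⇒≤ t<t″)) (ag-mono (<⇒≤ t″<t′) (ag-trans (ag-sym av) aw)))
              wide (ranked t″<t′ mt″ mt′) ag-refl a l)
            (¬Ag t<t″ mt″) Euz
        Eu′z : E u′ z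
        Eu′z = via (mark-between t<t′ mt mt′ (trans pt (≡-sym pt′)))

      -- These edges have old level t and join only equal labels at s, so the label classes are
      -- coloured separately by `levels t` with one palette.
      F-at : ∀ t → HB A (F at R ≥ t)
      F-at t {S} S? p no-clique =
        (λ u → proj₁ (part (lab u s)) u) , (λ u → proj₁ (proj₂ (part (lab u s))) u) , proper
        where
        Part : Fin k → Fin n → Set
        Part c u = S u × Q t u × lab u s ≡ c
        to : ∀ {c u v} → Part c u → Part c v → E u v × lev u v ≡ t → (F at R ≥ t) u v
        to {c} {u} {v} (_ , q , l) (_ , _ , l′) (Euv , refl) =
          f , F⇒R ≤-refl f , ¬R
          where
          f : F u v
          f = Euv , trans l (≡-sym l′) , q
          ¬R : ¬ R (suc (lev u v)) u v
          ¬R (inj₁ e) = E⇒≢ Euv e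
          ¬R (inj₂ (_ , t′ , _ , lev<t′ , (mt′ , _) , a)) = <⇒≱ lev<t′ (≤-lev (E⇒≢ Euv) mt′ a)
        part : ∀ c → Col (λ u v → E u v × lev u v ≡ t) (Part c) (A * p)
        part c = levels t (λ u → S? u ×-dec (Q? t u ×-dec lab u s ≟ᶠ c)) p
          (λ cl → no-clique (clique-mono proj₁ to (2 ^ p) cl))
        lev≡t : ∀ {u v} → (F at R ≥ t) u v → lev u v ≡ t
        lev≡t (f@(Euv , _) , r , ¬r) = ≤-antisym (≮⇒≥ λ t<lev → ¬r (F⇒R t<lev f)) (t≤lev r)
          where
          t≤lev : R t _ _ → t ≤ lev _ _
          t≤lev (inj₁ e) = contradiction e (E⇒≢ Euv)
          t≤lev (inj₂ (_ , t′ , _ , t≤t′ , (mt′ , _) , a)) = ≤-trans t≤t′ (≤-lev (E⇒≢ Euv) mt′ a)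
        proper : ∀ {u v} → S u → S v → (F at R ≥ t) u v → proj₁ (part (lab u s)) u ≢ proj₁ (part (lab v s)) v
        proper {u} {v} Su Sv e@((Euv , l , q) , _) eq =
          proj₂ (proj₂ (part (lab u s)))
            (Su , qu , refl) (Sv , Q-resp (subst (λ t → Ag t u v) (lev≡t e) (lev-agree u v)) qu , ≡-sym l)
            (Euv , lev≡t e) (trans eq (cong (λ c → proj₁ (part c) v) (≡-sym l)))
          where
          qu : Q t u
          qu = subst (λ t → Q t u) (lev≡t e) q

      F-bounded : HB (2 * A + 4) F
      F-bounded = Substitution.substitution F F? F-sym (λ (Euu , _) → E-irrefl Euu) R R?
        (inj₁ refl) R-sym R-trans R-step (suc D) R-bottom R-module A F-at (F⇒R z≤n)

    -- Ends with different labels at s are told apart by the label, all others by the colouring for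
    -- the parity of their old level. For p = 0 there is no room for label bits, but S is empty.
    levels′ : Levels (next-bound k A) M′
    levels′ s S? zero no-clique =
      (λ _ → 0) , (λ _ → 1≤2^ (next-bound k A * 0)) , λ {u} Su _ _ _ → no-clique (u , Su , tt)
    levels′ s {S} S? p@(suc _) no-clique = colour , colour-< , proper
      where
      B = 2 * A + 4
      F⇒E : ∀ {b u v} → F s b u v → E u v × lev′ u v ≡ s
      F⇒E {u = u} {v} (Euv , _ , _ , m′t , _) = Euv , trans (≡-sym (m′-m (ℓ u v) u)) m′t
      by-parity : ∀ b → Col (F s b) S (B * p)
      by-parity b = F-bounded s b S? p (λ c → no-clique (clique-mono id (λ _ _ → F⇒E) (2 ^ p) c))
      col : Bool → Fin n → ℕ
      col b = proj₁ (by-parity b)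
      col-< : ∀ b u → col b u < 2 ^ (B * p)
      col-< b = proj₁ (proj₂ (by-parity b))
      colour : Fin n → ℕ
      colour u = pair (B * p) (pair (B * p) (toℕ (lab u s)) (col false u)) (col true u)
      bits : k + B * p + B * p ≤ next-bound k A * p
      bits = begin
        k + B * p + B * p     ≤⟨ +-monoˡ-≤ (B * p) (+-monoˡ-≤ (B * p) (m≤m*n k p)) ⟩
        k * p + B * p + B * p ≡⟨ arith k B p ⟩
        (k + (B + B)) * p     ∎
        where
        open ≤-Reasoning
        arith : ∀ k B p → k * p + B * p + B * p ≡ (k + (B + B)) * p
        arith = solve-∀
      colour-< : ∀ u → colour u < 2 ^ (next-bound k A * p)
      colour-< u = <-≤-trans
        (pair-< {k + B * p} {B * p}
          (pair-< {k} {B * p} (<-trans (toℕ<n (lab u s)) (n<2^n k)) (col-< false u)) (col-< true u))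
        (2^-mono-≤ bits)
      apart : ∀ b {u v} → S u → S v → F s b u v → col false u ≡ col false v → col true u ≡ col true v → ⊥
      apart false Su Sv f eq _ = proj₂ (proj₂ (by-parity false)) Su Sv f eq
      apart true  Su Sv f _ eq = proj₂ (proj₂ (by-parity true)) Su Sv f eq
      proper : ∀ {u v} → S u → S v → E u v × lev′ u v ≡ s → colour u ≢ colour v
      proper {u} {v} Su Sv (Euv , lev≡) eq =
        let eq₁ , true≡ = pair-inj {B * p} (col-< true u) (col-< true v) eq
            lab≡ , false≡ = pair-inj {B * p} {toℕ (lab u s)} (col-< false u) (col-< false v) eq₁
        in apart (par (lev u v) u) Su Sv
             (Euv , toℕ-injective lab≡ , lev-mark u v , trans (m′-m (ℓ u v) u) lev≡ , refl) false≡ true≡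

  descend : ∀ r A (M : Marks) → Ranked r M → Levels A M → HB (bound k r A) E
  descend zero A M ranked levels = HB-resp {A = A} proj₁ (λ Euv → Euv , m≡0 _ _) (levels 0)
    where
    open Marks M
    m≡0 : ∀ t u → m t u ≡ 0
    m≡0 zero u = m-zero u
    m≡0 (suc t) u with m-suc t u
    -- At rank 0 a mark below the root would show no label, though its node contains u.
    ... | inj₁ e = contradiction (u , ag-refl , tt) (ranked (s≤s z≤n) (m-zero u) e)
    ... | inj₂ e = trans e (m≡0 t u)
  descend (suc r) A M ranked levels = descend r (next-bound k A) M′ ranked′ levels′
    where open Thinning M r ranked A levels

  all-marked : Marks
  all-marked = record { m = λ t _ → t ; m-zero = λ _ → refl ; m-suc = λ _ _ → inj₁ refl ; m-resp = λ _ _ → refl }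

  all-marked-levels : Levels 1 all-marked
  all-marked-levels s S? zero no-clique = (λ _ → 0) , (λ _ → s≤s z≤n) , λ {u} Su _ _ _ → no-clique (u , Su , tt)
  all-marked-levels s {S} S? (suc p) no-clique = (λ u → bit (side u s)) , (λ u → bit-< (side u s)) , proper
    where
    bit : Bool → ℕ
    bit false = 0
    bit true  = 1
    bit-inj : ∀ {b c} → bit b ≡ bit c → b ≡ c
    bit-inj {false} {false} _ = refl
    bit-inj {true}  {true}  _ = refl
    bit-< : ∀ b → bit b < 2 ^ (1 * suc p)
    bit-< b = <-≤-trans (bit<2 b) (2^-mono-≤ {1} {1 * suc p} (s≤s z≤n))
      where
      bit<2 : ∀ b → bit b < 2
      bit<2 false = s≤s z≤n
      bit<2 true  = ≤-refl
    proper : ∀ {u v} → S u → S v → E u v × ℓ u v ≡ s → bit (side u s) ≢ bit (side v s)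
    proper {u} {v} _ _ (Euv , refl) eq = 1+n≰n (≤-ℓ (E⇒≢ Euv) agree)
      where
      agree : Ag (suc (ℓ u v)) u v
      agree i (s≤s i≤ℓ) with m≤n⇒m<n∨m≡n i≤ℓ
      ... | inj₁ i<ℓ  = ℓ-agree u v i i<ℓ
      ... | inj₂ refl = bit-inj eq

  bounded : HB (bound k k 1) E
  bounded = descend k 1 all-marked (λ _ _ _ c → 1+n≰n (distinct-labels-≤ (λ u → lab u _) c)) all-marked-levels

-- Cliquewidth expressions

prefix : Bool → (ℕ → Bool) → ℕ → Bool
prefix b f zero    = b
prefix b f (suc i) = f i

-- A union keeps all labels, so its node and the child node carry the same label.
stay : {X : Set} → (ℕ → X) → ℕ → X
stay f zero    = f zero
stay f (suc t) = f t

-- The leaf u is the end of the branch side e u of the tree of unions, and lab e u t is its label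
-- in the subexpression reached after t steps, taken after the joins and renamings above the next union.
side : ∀ {k n} → CWExpr k n → Fin n → ℕ → Bool
side (vertex _) _ _ = false
side (union {m} e₁ e₂) u = [ (λ x → prefix false (side e₁ x)) , (λ y → prefix true (side e₂ y)) ]′ (splitAt m u)
side (join _ _ _ e) u = side e u
side (rename _ _ e) u = side e u

lab : ∀ {k n} → CWExpr k n → Fin n → ℕ → Fin k
lab (vertex a) _ _ = a
lab (union {m} e₁ e₂) u = [ (λ x → stay (lab e₁ x)) , (λ y → stay (lab e₂ y)) ]′ (splitAt m u)
lab (join _ _ _ e) u = lab e u
lab (rename i j e) u zero    = label (rename i j e) u
lab (rename i j e) u (suc t) = lab e u (suc t)

depth : ∀ {k n} → CWExpr k n → ℕ
depth (vertex _)     = 0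
depth (union e₁ e₂)  = suc (depth e₁ ⊔ depth e₂)
depth (join _ _ _ e) = depth e
depth (rename _ _ e) = depth e

lab-zero : ∀ {k n} (e : CWExpr k n) u → lab e u 0 ≡ label e u
lab-zero (vertex _) _ = refl
lab-zero (union {m} e₁ e₂) u with splitAt m u
... | inj₁ x = lab-zero e₁ x
... | inj₂ y = lab-zero e₂ y
lab-zero (join _ _ _ e) u = lab-zero e u
lab-zero (rename _ _ e) u = refl

label-rename : ∀ {k n} (i j : Fin k) (e : CWExpr k n) {u v} →
  label e u ≡ label e v → label (rename i j e) u ≡ label (rename i j e) v
label-rename i j e {u} {v} eq with eqF (label e u) i | eqF (label e v) i | cong (λ a → eqF a i) eq
... | true  | true  | refl = refl
... | false | false | refl = eq

agree-tail : ∀ {b f g t} → (∀ i → i < suc t → prefix b f i ≡ prefix b g i) → ∀ i → i < t → f i ≡ g i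
agree-tail a i i<t = a (suc i) (s≤s i<t)

agree-prefix : ∀ {b f g t} → (∀ i → i < t → f i ≡ g i) → ∀ i → i < suc t → prefix b f i ≡ prefix b g i
agree-prefix a zero    _         = refl
agree-prefix a (suc i) (s≤s i<t) = a i i<t

lab-step : ∀ {k n} (e : CWExpr k n) t {u v} → Agree (side e) (suc t) u v →
  lab e u (suc t) ≡ lab e v (suc t) → lab e u t ≡ lab e v t
lab-step (vertex _) _ _ _ = refl
lab-step (union {m} e₁ e₂) t {u} {v} with splitAt m u | splitAt m v
lab-step (union e₁ e₂) zero    | inj₁ _ | inj₁ _ = λ _ eq → eq
lab-step (union e₁ e₂) (suc t) | inj₁ _ | inj₁ _ = λ a → lab-step e₁ t (agree-tail a)
lab-step (union e₁ e₂) zero    | inj₂ _ | inj₂ _ = λ _ eq → eq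
lab-step (union e₁ e₂) (suc t) | inj₂ _ | inj₂ _ = λ a → lab-step e₂ t (agree-tail a)
... | inj₁ _ | inj₂ _ = λ a → contradiction (a 0 (s≤s z≤n)) λ ()
... | inj₂ _ | inj₁ _ = λ a → contradiction (a 0 (s≤s z≤n)) λ ()
lab-step (join _ _ _ e) t = lab-step e t
lab-step (rename i j e) zero {u} {v} a eq =
  label-rename i j e (trans (≡-sym (lab-zero e u)) (trans (lab-step e 0 a eq) (lab-zero e v)))
lab-step (rename i j e) (suc t) = lab-step e (suc t)

-- Equal labels are never separated on the way up; hence a join at the root treats u and v alike.
label-resp : ∀ {k n} (e : CWExpr k n) t {u v} → Agree (side e) t u v →
  lab e u t ≡ lab e v t → label e u ≡ label e v
label-resp e zero {u} {v} _ eq = trans (≡-sym (lab-zero e u)) (trans eq (lab-zero e v))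
label-resp e (suc t) a eq = label-resp e t (λ i i<t → a i (m<n⇒m<1+n i<t)) (lab-step e t a eq)

∨-resp : ∀ {a a′ b b′} → (a ≡ true → a′ ≡ true) → b ≡ b′ → a ∨ b ≡ true → a′ ∨ b′ ≡ true
∨-resp {true} f refl _ = cong (_∨ _) (f refl)
∨-resp {false} {true}  f refl _ = refl
∨-resp {false} {false} f refl e = e

lab-adj : ∀ {k n} (e : CWExpr k n) t {u u′ z} → Agree (side e) t u u′ → lab e u t ≡ lab e u′ t →
  ¬ Agree (side e) t u z → eadj e u z ≡ true → eadj e u′ z ≡ true
lab-adj (vertex _) _ _ _ _ ()
lab-adj (union _ _) zero _ _ ¬a = contradiction (λ _ ()) ¬a
lab-adj (union {m} e₁ e₂) (suc t) {u} {u′} {z} with splitAt m u | splitAt m u′ | splitAt m z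
... | inj₁ _ | inj₁ _ | inj₁ _ = λ a l ¬a → lab-adj e₁ t (agree-tail a) l (¬a ∘ agree-prefix)
... | inj₂ _ | inj₂ _ | inj₂ _ = λ a l ¬a → lab-adj e₂ t (agree-tail a) l (¬a ∘ agree-prefix)
... | inj₁ _ | inj₁ _ | inj₂ _ = λ _ _ _ ()
... | inj₂ _ | inj₂ _ | inj₁ _ = λ _ _ _ ()
... | inj₁ _ | inj₂ _ | _      = λ a → contradiction (a 0 (s≤s z≤n)) λ ()
... | inj₂ _ | inj₁ _ | _      = λ a → contradiction (a 0 (s≤s z≤n)) λ ()
lab-adj (join i j _ e) t {z = z} a l ¬a = ∨-resp (lab-adj e t a l ¬a)
  (cong (λ b → (eqF b i ∧ eqF (label e z) j) ∨ (eqF b j ∧ eqF (label e z) i)) (label-resp e t a l))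
lab-adj (rename _ _ _) zero _ _ ¬a = contradiction (λ _ ()) ¬a
lab-adj (rename _ _ e) (suc t) = lab-adj e (suc t)

side-injective : ∀ {k n} (e : CWExpr k n) {u v} → Agree (side e) (depth e) u v → u ≡ v
side-injective (vertex _) {zero} {zero} _ = refl
side-injective (union {m} e₁ e₂) {u} {v} with splitAt m u in p | splitAt m v in q
... | inj₁ x | inj₁ y = λ a → trans (≡-sym (splitAt⁻¹-↑ˡ p)) (trans
        (cong (_↑ˡ _) (side-injective e₁ λ i i< → agree-tail a i (<-≤-trans i< (m≤m⊔n _ _)))) (splitAt⁻¹-↑ˡ q))
... | inj₂ x | inj₂ y = λ a → trans (≡-sym (splitAt⁻¹-↑ʳ p)) (trans
        (cong (m ↑ʳ_) (side-injective e₂ λ i i< → agree-tail a i (<-≤-trans i< (m≤n⊔m (depth e₁) _)))) (splitAt⁻¹-↑ʳ q))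
... | inj₁ _ | inj₂ _ = λ a → contradiction (a 0 (s≤s z≤n)) λ ()
... | inj₂ _ | inj₁ _ = λ a → contradiction (a 0 (s≤s z≤n)) λ ()
side-injective (join _ _ _ e) = side-injective e
side-injective (rename _ _ e) = side-injective e

-- From powers of two to a polynomial

binary-log : ∀ w → Σ ℕ λ p → w < 2 ^ p × 2 ^ p ≤ suc (w + w)
binary-log zero = 0 , s≤s z≤n , s≤s z≤n
binary-log (suc w) with binary-log w
... | p , w< , ≤2w with m≤n⇒m<n∨m≡n w<
...   | inj₁ 1+w< = p , 1+w< , ≤-trans ≤2w (s≤s (+-mono-≤ (n≤1+n w) (n≤1+n w)))
...   | inj₂ 1+w≡ = suc p , subst (suc w <_) eq (m<m+n (suc w) (s≤s z≤n)) , ≤-trans (≤-reflexive (≡-sym eq)) (n≤1+n _)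
  where
  eq : suc w + suc w ≡ 2 ^ suc p
  eq = trans (cong₂ _+_ 1+w≡ 1+w≡) (2^-double p)

monomial : ℕ → ℕ → Poly
monomial zero    c = c ∷ []
monomial (suc d) c = 0 ∷ monomial d c

eval-monomial : ∀ d c x → eval (monomial d c) x ≡ x ^ d * c
eval-monomial zero c x = cong (c +_) (*-zeroʳ x)
eval-monomial (suc d) c x = trans (cong (x *_) (eval-monomial d c x)) (≡-sym (*-assoc x (x ^ d) c))

^-distribʳ-* : ∀ d x y → (x * y) ^ d ≡ x ^ d * y ^ d
^-distribʳ-* zero    x y = refl
^-distribʳ-* (suc d) x y = trans (cong (x * y *_) (^-distribʳ-* d x y)) ([m*n]*[o*p]≡[m*o]*[n*p] x y (x ^ d) (y ^ d))

-- The constant 1 serves w = 0; for positive w, 2w + 1 is at most 3w.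
bounding-poly : ℕ → Poly
bounding-poly A = 1 ∷ monomial A (3 ^ A)

≤-bounding-poly : ∀ A w → suc (w + w) ^ A ≤ eval (bounding-poly A) w
≤-bounding-poly A zero = ≤-reflexive (^-zeroˡ A)
≤-bounding-poly A w@(suc _) = begin
  suc (w + w) ^ A                       ≤⟨ ^-monoˡ-≤ A linear ⟩
  (w * 3) ^ A                           ≡⟨ ^-distribʳ-* A w 3 ⟩
  w ^ A * 3 ^ A                         ≡⟨ ≡-sym (eval-monomial A (3 ^ A) w) ⟩
  eval (monomial A (3 ^ A)) w           ≤⟨ m≤n*m _ w ⟩
  w * eval (monomial A (3 ^ A)) w       ≤⟨ n≤1+n _ ⟩
  suc (w * eval (monomial A (3 ^ A)) w) ∎
  where
  open ≤-Reasoning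
  arith : ∀ w → w + (w + w) ≡ w * 3
  arith = solve-∀
  linear : suc (w + w) ≤ w * 3
  linear = ≤-trans (+-monoˡ-≤ (w + w) {1} {w} (s≤s z≤n)) (≤-reflexive (arith w))

bounded-by-clique-number : ∀ k (G : Graph) → CliquewidthAtMost k G → HB (bound k k 1) (λ u v → adj G u v ≡ true)
bounded-by-clique-number k G (e , φ , adj≡) = System.bounded
  (λ u v → adj G u v ≡ true) (λ u v → adj G u v ≟ᵇ true)
  (λ {u} {v} → trans (sym G v u)) (λ {u} Euu → contradiction (trans (≡-sym Euu) (irrefl G u)) λ ())
  (side e ∘ to) (lab e ∘ to) (depth e) to-injective
  (λ t {u} {u′} {z} a l ¬a Euz → trans (adj≡ u′ z) (lab-adj e t a l ¬a (trans (≡-sym (adj≡ u z)) Euz)))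
  (λ t → lab-step e t)
  where
  open Inverse φ using (to; from; strictlyInverseʳ)
  to-injective : ∀ {u v} → Agree (side e ∘ to) (depth e) u v → u ≡ v
  to-injective {u} {v} a =
    trans (≡-sym (strictlyInverseʳ u)) (trans (cong from (side-injective e a)) (strictlyInverseʳ v))

clique→HasClique : ∀ (G : Graph) s → Clique (λ u v → adj G u v ≡ true) (λ _ → ⊤) s → HasClique G s
clique→HasClique G s c =
  let f , _ , f-adj = clique→fun (λ {u} {v} → trans (sym G v u)) s c
  in f , (λ i j eq → decidable-stable (i ≟ᶠ j) λ i≢j →
            contradiction (trans (≡-sym (f-adj i j i≢j)) (trans (cong (adj G (f i)) (≡-sym eq)) (irrefl G (f i)))) λ ()) ,
     f-adj

theorem1p1 : (k : ℕ) → Σ Poly λ f → (G : Graph) → CliquewidthAtMost k G →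
    (w : ℕ) → IsCliqueNumber G w → Colourable G (eval f w)
theorem1p1 k = bounding-poly A , λ G cw w (_ , ¬clique) →
  let p , w<2^p , 2^p≤ = binary-log w
      col , col-< , proper = bounded-by-clique-number k G cw {λ _ → ⊤} (λ _ → yes tt) p
        (λ c → ¬clique (clique→HasClique G (suc w) (clique-≤ w<2^p c)))
      -- Rounding up to a power of two costs only a constant factor: `2 ^ (A * p)` is the A-th power
      -- of a number at most 2w + 1.
      palette : 2 ^ (A * p) ≤ eval (bounding-poly A) w
      palette = ≤-trans (≤-reflexive (trans (cong (2 ^_) (*-comm A p)) (≡-sym (^-*-assoc 2 p A))))
                  (≤-trans (^-monoˡ-≤ A 2^p≤) (≤-bounding-poly A w))
  in (λ u → fromℕ< (<-≤-trans (col-< u) palette)) ,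
     λ u v Euv eq → proper tt tt Euv (fromℕ<-injective _ _ _ _ eq)
  where
  A = bound k k 1
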